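{- Let $\mathcal{A}$ and $\mathcal{B}$ be presentations of a transversal matroid $M$. Then the set $$L_{\mathcal{A},\mathcal{B}}=\{I\in L_\mathcal{A}: M[\mathcal{A}^I]=M[\mathcal{B}^J]\text{ for some } J\in L_\mathcal{B}\}$$ is a sublattice of $L_\mathcal{A}$. The sublattices $L_{\mathcal{A},\mathcal{B}}$ of $L_\mathcal{A}$ and $L_{\mathcal{B},\mathcal{A}}$ of $L_\mathcal{B}$ are isomorphic, and $T_\mathcal{A}\cap T_\mathcal{B}$ is a sublattice of both $T_\mathcal{A}$ and $T_\mathcal{B}$.
   Context: Let $r=r(M)$ and $[r]=\{1,\dots,r\}$. For a set system $\mathcal{A}=(A_i:i\in[r])$ on a finite set $E$, $M[\mathcal{A}]$ is the transversal matroid on $E$ whose independent sets are the partial transversals of $\mathcal{A}$; $\mathcal{A}$ is a presentation of $M[\mathcal{A}]$, with exactly $r$ sets. Fix $x\notin E$; for $I\subseteq[r]$, $\mathcal{A}^I$ is obtained from $\mathcal{A}$ by replacing $A_i$ by $A_i\cup\{x\}$ for each $i\in I$. Let $\sigma_\mathcal{A}(I)=I\cup\{k\in[r]-I: x\text{ is a coloop of } M[\mathcal{A}^I]\backslash A_k\}$; $L_\mathcal{A}$ is the lattice (under inclusion; join $\cup$, meet $\cap$) of $I\subseteq[r]$ with $\sigma_\mathcal{A}(I)=I$. $T_\mathcal{A}=\{M[\mathcal{A}^I]: I\in L_\mathcal{A}\}$ ordered by the weak order ($N_1\le_w N_2$ iff every independent set of $N_1$ is independent in $N_2$); it is a lattice.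 Similarly $L_\mathcal{B}$, $T_\mathcal{B}$, and $L_{\mathcal{B},\mathcal{A}}$ (with roles of $\mathcal{A},\mathcal{B}$ swapped). -}

module Defs where

open import Data.Nat using (ℕ; suc)
open import Data.Fin using (Fin; zero; suc)
open import Data.Fin.Subset using (Subset; _∈_; _∉_; _⊆_; _∪_; _∩_; ∣_∣)
open import Data.Vec using (_∷_; lookup)
open import Data.Product using (Σ; ∃; _×_)
open import Relation.Binary.PropositionalEquality using (_≡_)
open import Relation.Nullary using (¬_)
open import Function.Bundles using (_⇔_)

SetSystem : ℕ → ℕ → Set
SetSystem r m = Fin r → Subset m

PartialTransversal : ∀ {r m} → SetSystem r m → Subset m → Set
PartialTransversal {r} {m} S X =
  Σ (Fin m → Fin r) λ φ →
    (∀ e → e ∈ X → e ∈ S (φ e)) ×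
    (∀ e e′ → e ∈ X → e′ ∈ X → φ e ≡ φ e′ → e ≡ e′)

-- A matroid on Fin m, given by its independence predicate.
Matroid : ℕ → Set₁
Matroid m = Subset m → Set

M[_] : ∀ {r m} → SetSystem r m → Matroid m
M[ S ] = PartialTransversal S

_≈M_ : ∀ {m} → Matroid m → Matroid m → Set
N₁ ≈M N₂ = ∀ X → N₁ X ⇔ N₂ X

_≤w_ : ∀ {m} → Matroid m → Matroid m → Set
N₁ ≤w N₂ = ∀ X → N₁ X → N₂ X

HasRank : ∀ {m} → Matroid m → ℕ → Set
HasRank {m} N r = (∃ λ X → N X × ∣ X ∣ ≡ r) × (∀ X → N X → ∣ X ∣ Data.Nat.≤ r)
  where import Data.Nat

-- The extension: the ground set E ∪ {x} is Fin (suc n), with x = zero and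
-- the element e of E represented by suc e.
x : ∀ {n} → Fin (suc n)
x = zero

-- 𝒜^I : A_i is replaced by A_i ∪ {x} exactly when i ∈ I.
_^_ : ∀ {r n} → SetSystem r n → Subset r → SetSystem r (suc n)
(A ^ I) i = lookup I i ∷ A i

_＼_ : ∀ {n} → Matroid (suc n) → Subset n → Matroid (suc n)
(N ＼ D) X = N X × (∀ e → suc e ∈ X → e ∉ D)

IsBasisIn : ∀ {m} → Matroid m → Subset m → Subset m → Set
IsBasisIn N G B = B ⊆ G × N B × (∀ e → e ∈ G → e ∉ B → ¬ N (B Data.Fin.Subset.∪ Data.Fin.Subset.⁅ e ⁆))
  where import Data.Fin.Subset

-- Ground set of M[𝒜^I] \ A_k : (E ∪ {x}) − A_k.
groundDel : ∀ {n} → Subset n → Subset (suc n)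
groundDel D = Data.Bool.true ∷ Data.Vec.map Data.Bool.not D
  where import Data.Bool; import Data.Vec

XColoop : ∀ {r n} → SetSystem r n → Subset r → Fin r → Set
XColoop A I k = ∀ B → IsBasisIn (M[ A ^ I ] ＼ A k) (groundDel (A k)) B → x ∈ B

_∈σ[_]_ : ∀ {r n} → Fin r → SetSystem r n → Subset r → Set
k ∈σ[ A ] I = k ∈ I Data.Sum.⊎ (k ∉ I × XColoop A I k)
  where import Data.Sum

-- I ∈ L_𝒜  iff  σ_𝒜(I) = I  (since I ⊆ σ_𝒜(I) always, this is σ_𝒜(I) ⊆ I).
InL : ∀ {r n} → SetSystem r n → Subset r → Set
InL A I = ∀ k → k ∈σ[ A ] I → k ∈ I

InLAB : ∀ {r n} → SetSystem r n → SetSystem r n → Subset r → Set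
InLAB A B I = InL A I × ∃ λ J → InL B J × (M[ A ^ I ] ≈M M[ B ^ J ])

LAB : ∀ {r n} → SetSystem r n → SetSystem r n → Set
LAB A B = Σ (Subset _) (InLAB A B)

-- L_{𝒜,ℬ} is a sublattice of L_𝒜 (whose join is ∪ and meet is ∩).
IsSublatticeL : ∀ {r n} → SetSystem r n → SetSystem r n → Set
IsSublatticeL A B = ∀ I I′ → InLAB A B I → InLAB A B I′ →
  InLAB A B (I ∪ I′) × InLAB A B (I ∩ I′)

Isomorphic : ∀ {r n} → SetSystem r n → SetSystem r n → Set
Isomorphic A B =
  Σ (LAB A B → LAB B A) λ f → Σ (LAB B A → LAB A B) λ g →
    (∀ p → proj₁ (g (f p)) ≡ proj₁ p) ×
    (∀ q → proj₁ (f (g q)) ≡ proj₁ q) ×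
    (∀ p p′ → (proj₁ p ⊆ proj₁ p′) ⇔ (proj₁ (f p) ⊆ proj₁ (f p′)))
  where open import Data.Product using (proj₁)

-- Elements of T_𝒜 are the matroids M[𝒜^I] with I ∈ L_𝒜; we refer to them
-- through such indices I.  M[𝒜^I] is a join (least upper bound) in T_𝒜,
-- under ≤w, of M[𝒜^I₁] and M[𝒜^I₂].
IsJoinInT : ∀ {r n} → SetSystem r n → (I₁ I₂ I : Subset r) → Set
IsJoinInT A I₁ I₂ I = InL A I ×
  M[ A ^ I₁ ] ≤w M[ A ^ I ] × M[ A ^ I₂ ] ≤w M[ A ^ I ] ×
  (∀ I′ → InL A I′ → M[ A ^ I₁ ] ≤w M[ A ^ I′ ] → M[ A ^ I₂ ] ≤w M[ A ^ I′ ] →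
     M[ A ^ I ] ≤w M[ A ^ I′ ])

IsMeetInT : ∀ {r n} → SetSystem r n → (I₁ I₂ I : Subset r) → Set
IsMeetInT A I₁ I₂ I = InL A I ×
  M[ A ^ I ] ≤w M[ A ^ I₁ ] × M[ A ^ I ] ≤w M[ A ^ I₂ ] ×
  (∀ I′ → InL A I′ → M[ A ^ I′ ] ≤w M[ A ^ I₁ ] → M[ A ^ I′ ] ≤w M[ A ^ I₂ ] →
     M[ A ^ I′ ] ≤w M[ A ^ I ])

-- T_𝒜 ∩ T_ℬ is a sublattice of T_𝒜.  A member M[𝒜^I] of T_𝒜 lies in T_ℬ
-- iff I ∈ L_{𝒜,ℬ}.  Joins and meets (taken in T_𝒜) of members of
-- T_𝒜 ∩ T_ℬ lie again in T_𝒜 ∩ T_ℬ.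
IsSublatticeT : ∀ {r n} → SetSystem r n → SetSystem r n → Set
IsSublatticeT A B = ∀ I₁ I₂ I → InLAB A B I₁ → InLAB A B I₂ →
  (IsJoinInT A I₁ I₂ I → InLAB A B I) × (IsMeetInT A I₁ I₂ I → InLAB A B I)

IsPresentation : ∀ {r n} → Matroid n → SetSystem r n → Set
IsPresentation {r} M A = (M ≈M M[ A ]) × HasRank M r

{-# OPTIONS --safe #-}

-- Call a set Y independent in M[𝒜] tight, with support D ⊆ [r], if all its elements
-- lie only in sets A_i with i ∈ D and |Y| = |D|.  For X independent in M, X ∪ x is
-- dependent in M[𝒜^I] iff I is contained in the support of a tight subset of X, and
-- L_𝒜 consists of the intersections of such supports; supports are closed under union,
-- hence so is L_𝒜.  As M[𝒜^{I∪I′}] has as independent sets those of M[𝒜^I] together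
-- with those of M[𝒜^{I′}], joins in L_{𝒜,ℬ} are immediate.
--
-- For meets, suppose M[𝒜^I] = M[ℬ^J].  A minimal set that spans x is tight for both 𝒜
-- and ℬ, so I and J are the intersections of the two supports (D , E) of common tight
-- sets.  If (D₁ , E₁) and (D₂ , E₂) are such pairs then M[𝒜^{D₁∩D₂}] = M[ℬ^{E₁∩E₂}];
-- adding enough copies of x makes (D₁ ∩ D₂ , E₁ ∩ E₂) the supports of a common tight
-- set of the extended matroid, and the argument can be iterated.  So
-- M[𝒜^{I∩I′}] = M[ℬ^{J∩J′}] holds in some extension of M, and thus for M itself.
module Submission where

open import Defs
open import Data.Nat using (ℕ; zero; suc; _+_; _≤_; _<_; z≤n; s≤s; _≤?_)
open import Data.Nat.Properties using (≤-trans; ≤-reflexive; <-≤-trans; ≰⇒>; <⇒≱; +-suc; m≤m+n)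
open import Data.Bool using (true; false)
open import Data.Fin using (Fin; zero; suc)
open import Data.Fin.Properties using (_≟_; any?; all?; suc-injective)
open import Data.Fin.Subset using (Subset; _∈_; _∉_; _⊆_; _⊂_; _⊃_; _∪_; _∩_; _-_; ∣_∣; ⁅_⁆; ⊤; ⊥)
open import Data.Fin.Subset.Properties using (_∈?_; _⊆?_; anySubset?; ⊆-antisym; ∉⊥; ∈⊤; ∣p∣≤n; ∣⊤∣≡n; x∈⁅x⁆; x∈⁅y⁆⇒x≡y; x∈p∩q⁺; x∈p∩q⁻; x∈p∪q⁺; x∈p∪q⁻; p⊆p∪q; q⊆p∪q; p∩q⊆p; p∩q⊆q; ∩-idem; ∩-identityˡ; ∪-identityʳ; p─q⊆p; x∈p∧x≢y⇒x∈p-y; x∈p⇒∣p-x∣<∣p∣; x∈p⇒p-x⊂p; drop-there)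
open import Data.Fin.Subset.Induction using (Acc; acc; ⊂-wellFounded; ⊃-wellFounded)
open import Data.Vec using ([]; _∷_; tabulate; tail; here; there)
open import Data.Vec.Properties using (lookup∘tabulate; lookup⇒[]=; []=⇒lookup)
open import Data.Product using (_×_; Σ; ∃; ∃₂; _,_; proj₁; proj₂)
open import Data.Sum using (_⊎_; inj₁; inj₂; [_,_]′)
open import Function using (_∘_; id; flip)
open import Function.Bundles using (mk⇔; Equivalence)
open import Relation.Binary.PropositionalEquality using (_≡_; _≢_; refl; sym; trans; cong; subst; subst₂)
open import Relation.Nullary using (¬_; Dec; yes; no; does; contradiction)
open import Relation.Nullary.Decidable using (_×-dec_; _⊎-dec_; ¬?; dec-true; decidable-stable; _→-dec_; map′)

-- Finite subsets and counting

separate : ∀ {n} {P : Fin n → Set} → (∀ i → Dec (P i)) → Subset n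
separate P? = tabulate (does ∘ P?)

module _ {n} {P : Fin n → Set} (P? : ∀ i → Dec (P i)) where

  separate⁺ : ∀ {i} → P i → i ∈ separate P?
  separate⁺ {i} p = lookup⇒[]= i _ (trans (lookup∘tabulate (does ∘ P?) i) (dec-true (P? i) p))

  separate⁻ : ∀ {i} → i ∈ separate P? → P i
  separate⁻ {i} i∈ with P? i | trans (sym (lookup∘tabulate (does ∘ P?) i)) ([]=⇒lookup i∈)
  ... | yes p | _ = p

x∉p-x : ∀ {n} (p : Subset n) i → i ∉ p - i
x∉p-x (true  ∷ p) zero ()
x∉p-x (false ∷ p) zero ()
x∉p-x (_ ∷ p) (suc i) (there i∈) = x∉p-x p i i∈

⊈⇒∃ : ∀ {n} {P Q : Subset n} → ¬ P ⊆ Q → ∃ λ i → i ∈ P × i ∉ Q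
⊈⇒∃ {P = P} {Q} P⊈Q with any? (λ i → (i ∈? P) ×-dec ¬? (i ∈? Q))
... | yes w = w
... | no ∄ = contradiction (λ {i} i∈P → decidable-stable (i ∈? Q) λ i∉Q → ∄ (i , i∈P , i∉Q)) P⊈Q

-- `f` takes the membership proof as an argument, so that its values may come from existence proofs,
-- as in `∣∣-onto-≤`.
∣∣-inj-≤ : ∀ {a b} (P : Subset a) {Q : Subset b} (f : ∀ {e} → e ∈ P → Fin b) →
  (∀ {e} (p : e ∈ P) → f p ∈ Q) →
  (∀ {e e′} (p : e ∈ P) (p′ : e′ ∈ P) → f p ≡ f p′ → e ≡ e′) →
  ∣ P ∣ ≤ ∣ Q ∣
∣∣-inj-≤ [] f f∈ inj = z≤n
∣∣-inj-≤ (false ∷ P) f f∈ inj =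
  ∣∣-inj-≤ P (f ∘ there) (f∈ ∘ there) λ p p′ eq → suc-injective (inj (there p) (there p′) eq)
∣∣-inj-≤ (true ∷ P) {Q} f f∈ inj =
  <-≤-trans (s≤s (∣∣-inj-≤ P {Q - f here} (f ∘ there)
      (λ p → x∈p∧x≢y⇒x∈p-y (f∈ (there p)) λ eq → contradiction (inj (there p) here eq) λ ())
      (λ p p′ eq → suc-injective (inj (there p) (there p′) eq))))
    (x∈p⇒∣p-x∣<∣p∣ (f∈ here))

∣∣-onto-≤ : ∀ {a b} {P : Subset a} {Q : Subset b} (f : Fin a → Fin b) →
  (∀ {i} → i ∈ Q → ∃ λ e → e ∈ P × f e ≡ i) → ∣ Q ∣ ≤ ∣ P ∣
∣∣-onto-≤ {Q = Q} f onto = ∣∣-inj-≤ Q (proj₁ ∘ onto) (proj₁ ∘ proj₂ ∘ onto)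
  λ p p′ eq → trans (sym (proj₂ (proj₂ (onto p)))) (trans (cong f eq) (proj₂ (proj₂ (onto p′))))

-- Pigeonhole: if `i` were missed, `f` would inject `P` into `Q - i`, which is smaller than `P`.
inj-onto : ∀ {a b} {P : Subset a} {Q : Subset b} (f : Fin a → Fin b) →
  (∀ e → e ∈ P → f e ∈ Q) → (∀ e e′ → e ∈ P → e′ ∈ P → f e ≡ f e′ → e ≡ e′) →
  ∣ Q ∣ ≤ ∣ P ∣ → ∀ {i} → i ∈ Q → ∃ λ e → e ∈ P × f e ≡ i
inj-onto {P = P} {Q} f f∈ inj ∣Q∣≤∣P∣ {i} i∈Q with any? (λ e → (e ∈? P) ×-dec (f e ≟ i))
... | yes w = w
... | no ∄ = contradiction (<-≤-trans (x∈p⇒∣p-x∣<∣p∣ i∈Q) ∣Q∣≤∣P∣)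
  (λ lt → <⇒≱ lt (∣∣-inj-≤ P (λ {e} _ → f e)
    (λ {e} p → x∈p∧x≢y⇒x∈p-y (f∈ e p) λ eq → ∄ (e , p , eq))
    (λ {e} {e′} → inj e e′)))

-- Matchings, tight sets and cores

IsMatching : ∀ {r m} → SetSystem r m → Subset m → (Fin m → Fin r) → Set
IsMatching A X φ =
  (∀ e → e ∈ X → e ∈ A (φ e)) ×
  (∀ e e′ → e ∈ X → e′ ∈ X → φ e ≡ φ e′ → e ≡ e′)

Avoiding : ∀ {r m} → SetSystem r m → Subset m → Fin r → Set
Avoiding A X i = ∃ λ φ → IsMatching A X φ × (∀ e → e ∈ X → φ e ≢ i)

matching-⊆ : ∀ {r m} {A : SetSystem r m} {X Y φ} → Y ⊆ X → IsMatching A X φ → IsMatching A Y φ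
matching-⊆ Y⊆X (φ∈ , inj) = (λ e e∈ → φ∈ e (Y⊆X e∈)) , λ e e′ e∈ e′∈ → inj e e′ (Y⊆X e∈) (Y⊆X e′∈)

_[_↦_] : ∀ {m r} → (Fin m → Fin r) → Fin m → Fin r → Fin m → Fin r
(φ [ e ↦ i ]) e′ with e′ ≟ e
... | yes _ = i
... | no  _ = φ e′

-- e may already lie in X.
reroute : ∀ {r m} {A : SetSystem r m} {X φ e i} → IsMatching A X φ → (∀ e′ → e′ ∈ X → φ e′ ≢ i) →
  e ∈ A i → IsMatching A (X ∪ ⁅ e ⁆) (φ [ e ↦ i ])
reroute {A = A} {X} {φ} {e} {i} (φ∈ , inj) miss e∈Ai = ∈′ , inj′
  where
  old : ∀ {e′} → e′ ∈ X ∪ ⁅ e ⁆ → e′ ≢ e → e′ ∈ X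
  old {e′} p ne with x∈p∪q⁻ X ⁅ e ⁆ p
  ... | inj₁ q = q
  ... | inj₂ q = contradiction (x∈⁅y⁆⇒x≡y e q) ne
  ∈′ : ∀ e′ → e′ ∈ X ∪ ⁅ e ⁆ → e′ ∈ A ((φ [ e ↦ i ]) e′)
  ∈′ e′ p with e′ ≟ e
  ... | yes refl = e∈Ai
  ... | no ne = φ∈ e′ (old p ne)
  inj′ : ∀ e₁ e₂ → e₁ ∈ X ∪ ⁅ e ⁆ → e₂ ∈ X ∪ ⁅ e ⁆ → (φ [ e ↦ i ]) e₁ ≡ (φ [ e ↦ i ]) e₂ → e₁ ≡ e₂
  inj′ e₁ e₂ p₁ p₂ eq with e₁ ≟ e | e₂ ≟ e
  ... | yes refl | yes refl = refl
  ... | yes refl | no ne = contradiction (sym eq) (miss e₂ (old p₂ ne))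
  ... | no ne | yes refl = contradiction eq (miss e₁ (old p₁ ne))
  ... | no ne₁ | no ne₂ = inj e₁ e₂ (old p₁ ne₁) (old p₂ ne₂) eq

record Tight {r m} (A : SetSystem r m) (Y : Subset m) (D : Subset r) : Set where
  constructor tight
  field
    indep : M[ A ] Y
    nbrs  : ∀ {e i} → e ∈ Y → e ∈ A i → i ∈ D
    -- The reverse inequality follows from `indep` and `nbrs`: a matching injects `Y` into `D`.
    size  : ∣ D ∣ ≤ ∣ Y ∣

open Tight

covered : ∀ {r m} {A : SetSystem r m} {Y D φ} → Tight A Y D → IsMatching A Y φ →
  ∀ {i} → i ∈ D → ∃ λ e → e ∈ Y × φ e ≡ i
covered {φ = φ} T (φ∈ , inj) = inj-onto φ (λ e e∈ → nbrs T e∈ (φ∈ e e∈)) inj (size T)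

-- A matching of `X` already fills `D` with elements of `Y`, so injectivity leaves no index of `D`
-- to other elements.
covered-within : ∀ {r m} {A : SetSystem r m} {X Y D φ} → Tight A Y D → Y ⊆ X → IsMatching A X φ →
  ∀ {e} → e ∈ X → φ e ∈ D → e ∈ Y
covered-within {A = A} {Y = Y} T Y⊆X φm {e} e∈X φe∈D
  with covered T (matching-⊆ {A = A} Y⊆X φm) φe∈D
... | e′ , e′∈Y , eq = subst (_∈ Y) (proj₂ φm e′ e (Y⊆X e′∈Y) e∈X eq) e′∈Y

tight-onto : ∀ {r m} {A : SetSystem r m} {Y D φ} → IsMatching A Y φ →
  (∀ {e i} → e ∈ Y → e ∈ A i → i ∈ D) → (∀ {i} → i ∈ D → ∃ λ e → e ∈ Y × φ e ≡ i) → Tight A Y D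
tight-onto {φ = φ} φm nb onto = tight (φ , φm) nb (∣∣-onto-≤ φ onto)

-- D is the set of indices used by every matching of X.
record Core {r m} (A : SetSystem r m) (X : Subset m) : Set where
  field
    Y       : Subset m
    D       : Subset r
    Y⊆X     : Y ⊆ X
    istight : Tight A Y D
    free    : ∀ {i} → i ∉ D → Avoiding A X i

-- Alternating paths: starting from the indices missed by φ, an index φ e is freed
-- whenever e has an already freed neighbour; D is what remains.
abstract
  core : ∀ {r m} (A : SetSystem r m) {X} → M[ A ] X → Core A X
  core {r} {m} A {X} (φ , φm) = go D₀ (⊂-wellFounded D₀) (separate⁻ hit?)
      λ i∉ → φ , (φm , λ e e∈ eq → i∉ (separate⁺ hit? (e , e∈ , eq))) , λ _ _ → refl
    where
    hit? : ∀ i → Dec (∃ λ e → e ∈ X × φ e ≡ i)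
    hit? i = any? λ e → (e ∈? X) ×-dec (φ e ≟ i)
    D₀ : Subset r
    D₀ = separate hit?

    -- Agreement with `φ` on elements still matched into `D` guarantees that rerouting such an `e`
    -- vacates `φ e`.
    Freed : Subset r → Fin r → Set
    Freed D i = ∃ λ ψ → (IsMatching A X ψ × (∀ e → e ∈ X → ψ e ≢ i)) ×
                        (∀ {e} → e ∈ X → φ e ∈ D → ψ e ≡ φ e)

    go : ∀ D → Acc _⊂_ D → (∀ {i} → i ∈ D → ∃ λ e → e ∈ X × φ e ≡ i) →
         (∀ {i} → i ∉ D → Freed D i) → Core A X
    go D (acc rs) hit freed
      with any? (λ e → (e ∈? X) ×-dec ((φ e ∈? D) ×-dec any? (λ i → (e ∈? A i) ×-dec ¬? (i ∈? D))))
    -- Elements of `X` matched into `D` now have all their neighbours in `D`, so they form the tight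
    -- set.
    ... | no ∄ = record
      { Y = separate Y?
      ; D = D
      ; Y⊆X = proj₁ ∘ separate⁻ Y?
      ; istight = tight-onto {A = A} (matching-⊆ {A = A} (proj₁ ∘ separate⁻ Y?) φm)
          (λ {e} {i} e∈Y e∈Ai → decidable-stable (i ∈? D) λ i∉D →
             let e∈X , φe∈D = separate⁻ Y? e∈Y in ∄ (e , e∈X , φe∈D , i , e∈Ai , i∉D))
          (λ i∈D → let e , e∈X , eq = hit i∈D in
             e , separate⁺ Y? (e∈X , subst (_∈ D) (sym eq) i∈D) , eq)
      ; free = λ i∉D → let ψ , ψa , _ = freed i∉D in ψ , ψa
      }
      where
      Y? : ∀ e → Dec (e ∈ X × φ e ∈ D)
      Y? e = (e ∈? X) ×-dec (φ e ∈? D)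
    ... | yes (e , e∈X , φe∈D , i , e∈Ai , i∉D) =
      go (D - φ e) (rs (x∈p⇒p-x⊂p φe∈D)) (hit ∘ shrink) freed′
      where
      shrink : D - φ e ⊆ D
      shrink = p─q⊆p D ⁅ φ e ⁆
      i≢φe : i ≢ φ e
      i≢φe refl = i∉D φe∈D
      freed′ : ∀ {k} → k ∉ D - φ e → Freed (D - φ e) k
      freed′ {k} k∉ with k ≟ φ e
      ... | no k≢ = let ψ , ψa , agree = freed (λ k∈D → k∉ (x∈p∧x≢y⇒x∈p-y k∈D k≢)) in
                    ψ , ψa , λ e∈ φe∈ → agree e∈ (shrink φe∈)
      ... | yes refl with freed i∉D
      ...   | ψ , (ψm , miss) , agree =
        ψ [ e ↦ i ] , (matching-⊆ {A = A} (p⊆p∪q _) (reroute {A = A} ψm miss e∈Ai) , miss′) , agree′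
        where
        miss′ : ∀ e′ → e′ ∈ X → (ψ [ e ↦ i ]) e′ ≢ φ e
        miss′ e′ e′∈X eq with e′ ≟ e
        ... | yes refl = i≢φe eq
        ... | no ne = ne (proj₂ ψm e′ e e′∈X e∈X (trans eq (sym (agree e∈X φe∈D))))
        agree′ : ∀ {e′} → e′ ∈ X → φ e′ ∈ D - φ e → (ψ [ e ↦ i ]) e′ ≡ φ e′
        agree′ {e′} e′∈X φe′∈ with e′ ≟ e
        ... | yes refl = contradiction φe′∈ (x∉p-x D (φ e))
        ... | no ne = agree e′∈X (shrink φe′∈)

-- Unions and intersections of tight sets

abstract
  -- `Z` is `Y` with those elements of `Y′` whose partner lies outside `D`. As `Y` is matched into
  -- `D`, the two matchings combine; the last three components record how `Z` arises.
  tight-∪ : ∀ {r m} {A : SetSystem r m} {Y Y′ D D′} → Tight A Y D → (T′ : Tight A Y′ D′) →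
    ∃ λ Z → Tight A Z (D ∪ D′) × Y ⊆ Z ×
      (∀ {e} → e ∈ Z → e ∈ Y ⊎ (e ∈ Y′ × proj₁ (indep T′) e ∉ D)) ×
      (∀ {e} → e ∈ Y′ → proj₁ (indep T′) e ∉ D → e ∈ Z)
  tight-∪ {r} {m} {A} {Y} {Y′} {D} {D′} T@(tight (φ , φ∈ , inj) nb _) T′@(tight (φ′ , φ′∈ , inj′) nb′ _) =
    separate Z? , tight-onto {A = A} (χ∈ , χinj) nbZ onto , Y⊆Z , sep⁻ , λ e∈ ∉D → separate⁺ Z? (inj₂ (e∈ , ∉D))
    where
    Z? : ∀ e → Dec (e ∈ Y ⊎ (e ∈ Y′ × φ′ e ∉ D))
    Z? e = (e ∈? Y) ⊎-dec ((e ∈? Y′) ×-dec ¬? (φ′ e ∈? D))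
    sep⁻ : ∀ {e} → e ∈ separate Z? → e ∈ Y ⊎ (e ∈ Y′ × φ′ e ∉ D)
    sep⁻ = separate⁻ Z?
    Y⊆Z : Y ⊆ separate Z?
    Y⊆Z = separate⁺ Z? ∘ inj₁
    χ : Fin m → Fin r
    χ e with e ∈? Y
    ... | yes _ = φ e
    ... | no  _ = φ′ e
    new : ∀ {e} → e ∈ separate Z? → e ∉ Y → e ∈ Y′ × φ′ e ∉ D
    new e∈ e∉Y = [ (λ e∈Y → contradiction e∈Y e∉Y) , id ]′ (sep⁻ e∈)
    χ∈ : ∀ e → e ∈ separate Z? → e ∈ A (χ e)
    χ∈ e e∈ with e ∈? Y
    ... | yes p = φ∈ e p
    ... | no ¬p = φ′∈ e (proj₁ (new e∈ ¬p))
    χinj : ∀ e e′ → e ∈ separate Z? → e′ ∈ separate Z? → χ e ≡ χ e′ → e ≡ e′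
    χinj e e′ e∈ e′∈ eq with e ∈? Y | e′ ∈? Y
    ... | yes p | yes p′ = inj e e′ p p′ eq
    ... | no ¬p | no ¬p′ = inj′ e e′ (proj₁ (new e∈ ¬p)) (proj₁ (new e′∈ ¬p′)) eq
    ... | yes p | no ¬p′ = contradiction (subst (_∈ D) eq (nb p (φ∈ e p))) (proj₂ (new e′∈ ¬p′))
    ... | no ¬p | yes p′ = contradiction (subst (_∈ D) (sym eq) (nb p′ (φ∈ e′ p′))) (proj₂ (new e∈ ¬p))
    nbZ : ∀ {e i} → e ∈ separate Z? → e ∈ A i → i ∈ D ∪ D′
    nbZ e∈ e∈Ai = x∈p∪q⁺ ([ (λ p → inj₁ (nb p e∈Ai)) , (λ (p , _) → inj₂ (nb′ p e∈Ai)) ]′ (sep⁻ e∈))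
    χ-old : ∀ {e} → e ∈ Y → χ e ≡ φ e
    χ-old {e} p with e ∈? Y
    ... | yes _ = refl
    ... | no ¬p = contradiction p ¬p
    χ-new : ∀ {e} → e ∉ Y → χ e ≡ φ′ e
    χ-new {e} ¬p with e ∈? Y
    ... | yes p = contradiction p ¬p
    ... | no _ = refl
    onto : ∀ {i} → i ∈ D ∪ D′ → ∃ λ e → e ∈ separate Z? × χ e ≡ i
    onto {i} i∈ with i ∈? D | x∈p∪q⁻ D D′ i∈
    ... | yes i∈D | _ = let e , e∈Y , eq = covered T (φ∈ , inj) i∈D in
                        e , Y⊆Z e∈Y , trans (χ-old e∈Y) eq
    ... | no i∉D | inj₁ i∈D = contradiction i∈D i∉D
    ... | no i∉D | inj₂ i∈D′ with covered T′ (φ′∈ , inj′) i∈D′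
    ...   | e , e∈Y′ , refl = e , separate⁺ Z? (inj₂ (e∈Y′ , i∉D)) , χ-new (λ e∈Y → i∉D (nb e∈Y (φ′∈ e e∈Y′)))

-- A single matching of `W` fills `D` from `Y` and `D′` from `Y′`, so by injectivity it fills
-- `D ∩ D′` from `Y ∩ Y′`.
tight-∩ : ∀ {r m} {A : SetSystem r m} {W Y Y′ D D′} → M[ A ] W → Y ⊆ W → Y′ ⊆ W →
  Tight A Y D → Tight A Y′ D′ → Tight A (Y ∩ Y′) (D ∩ D′)
tight-∩ {A = A} {W} {Y} {Y′} {D} {D′} (θ , θm) Y⊆W Y′⊆W T T′ =
  tight-onto {A = A} (matching-⊆ {A = A} (Y⊆W ∘ p∩q⊆p Y Y′) θm)
    (λ e∈ e∈Ai → let p , p′ = x∈p∩q⁻ Y Y′ e∈ in x∈p∩q⁺ (nbrs T p e∈Ai , nbrs T′ p′ e∈Ai))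
    λ i∈ → let i∈D , i∈D′ = x∈p∩q⁻ D D′ i∈
               e , e∈Y , eq = covered T (matching-⊆ {A = A} Y⊆W θm) i∈D
           in e , x∈p∩q⁺ (e∈Y , covered-within T′ Y′⊆W θm (Y⊆W e∈Y) (subst (_∈ D′) (sym eq) i∈D′)) , eq

-- Adding and deleting one element

x∈^⁺ : ∀ {r m} (A : SetSystem r m) {I : Subset r} {i} → i ∈ I → zero ∈ (A ^ I) i
x∈^⁺ A {I} {i} i∈I = lookup⇒[]= zero _ ([]=⇒lookup i∈I)

x∈^⁻ : ∀ {r m} (A : SetSystem r m) {I : Subset r} {i} → zero ∈ (A ^ I) i → i ∈ I
x∈^⁻ A {I} {i} x∈ = lookup⇒[]= i I ([]=⇒lookup x∈)

-- Undoes `_^_`: `(A ^ I) ↓` equals `A` by computation, so the lemmas on `A ↓` apply directly to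
-- extensions.
_↓ : ∀ {r m} → SetSystem r (suc m) → SetSystem r m
(A ↓) i = tail (A i)

↓⁺ : ∀ {r m} (A : SetSystem r (suc m)) {i e} → suc e ∈ A i → e ∈ (A ↓) i
↓⁺ A {i} p with A i
... | _ ∷ _ = drop-there p

↓⁻ : ∀ {r m} (A : SetSystem r (suc m)) {i e} → e ∈ (A ↓) i → suc e ∈ A i
↓⁻ A {i} p with A i
... | _ ∷ _ = there p

indep-↓ : ∀ {r m} (A : SetSystem r (suc m)) {b X} → M[ A ] (b ∷ X) → M[ A ↓ ] X
indep-↓ A (φ , φ∈ , inj) = φ ∘ suc , (λ e e∈ → ↓⁺ A (φ∈ (suc e) (there e∈))) ,
  λ e e′ e∈ e′∈ eq → suc-injective (inj (suc e) (suc e′) (there e∈) (there e′∈) eq)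

indep-∷ : ∀ {r m} (A : SetSystem r (suc m)) {i X} → Avoiding (A ↓) X i → zero ∈ A i → M[ A ] (true ∷ X)
indep-∷ {r} {m} A {i} {X} (φ , (φ∈ , inj) , miss) x∈ = φ⁺ , ∈⁺ , inj⁺
  where
  φ⁺ : Fin (suc m) → Fin r
  φ⁺ zero = i
  φ⁺ (suc e) = φ e
  ∈⁺ : ∀ e → e ∈ true ∷ X → e ∈ A (φ⁺ e)
  ∈⁺ zero _ = x∈
  ∈⁺ (suc e) (there e∈) = ↓⁻ A (φ∈ e e∈)
  inj⁺ : ∀ e e′ → e ∈ true ∷ X → e′ ∈ true ∷ X → φ⁺ e ≡ φ⁺ e′ → e ≡ e′
  inj⁺ zero zero _ _ _ = refl
  inj⁺ zero (suc e) _ (there p) eq = contradiction (sym eq) (miss e p)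
  inj⁺ (suc e) zero (there p) _ eq = contradiction eq (miss e p)
  inj⁺ (suc e) (suc e′) (there p) (there p′) eq = cong suc (inj e e′ p p′ eq)

-- A matching is a total function, so `zero` needs the default value `i₀` although it is outside the
-- set.
indep-false : ∀ {r m} (A : SetSystem r (suc m)) {X} → Fin r → M[ A ↓ ] X → M[ A ] (false ∷ X)
indep-false {r} {m} A {X} i₀ (φ , φ∈ , inj) = φ⁺ , ∈⁺ , inj⁺
  where
  φ⁺ : Fin (suc m) → Fin r
  φ⁺ zero = i₀
  φ⁺ (suc e) = φ e
  ∈⁺ : ∀ e → e ∈ false ∷ X → e ∈ A (φ⁺ e)
  ∈⁺ (suc e) (there e∈) = ↓⁻ A (φ∈ e e∈)
  inj⁺ : ∀ e e′ → e ∈ false ∷ X → e′ ∈ false ∷ X → φ⁺ e ≡ φ⁺ e′ → e ≡ e′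
  inj⁺ (suc e) (suc e′) (there p) (there p′) eq = cong suc (inj e e′ p p′ eq)

-- The partner of `zero` would lie in `D`, which any matching of `X` already fills from `Y`.
tight-blocks : ∀ {r m} (A : SetSystem r (suc m)) {X Y D} → Tight (A ↓) Y D → Y ⊆ X →
  (∀ {i} → zero ∈ A i → i ∈ D) → ¬ M[ A ] (true ∷ X)
tight-blocks A {X} T Y⊆X x-nbrs ind@(θ , θ∈ , inj)
  with covered T (matching-⊆ {A = A ↓} Y⊆X (proj₂ (indep-↓ A ind))) (x-nbrs (θ∈ zero here))
... | e , e∈Y , eq with inj (suc e) zero (there (Y⊆X e∈Y)) here eq
...   | ()

abstract
  -- Recursion on the ground set: `zero` can be added exactly when it has a neighbour outside the
  -- core support of the rest.
  indep? : ∀ {r m} → Fin r → (A : SetSystem r m) → ∀ X → Dec (M[ A ] X)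
  indep? i₀ A [] = yes ((λ ()) , (λ ()) , λ ())
  indep? i₀ A (false ∷ X) = map′ (indep-false A i₀) (indep-↓ A) (indep? i₀ (A ↓) X)
  indep? i₀ A (true ∷ X) with indep? i₀ (A ↓) X
  ... | no ¬ind = no (¬ind ∘ indep-↓ A)
  ... | yes ind with any? (λ i → (zero ∈? A i) ×-dec ¬? (i ∈? Core.D (core (A ↓) ind)))
  ...   | yes (i , x∈ , i∉D) = yes (indep-∷ A (Core.free (core (A ↓) ind) i∉D) x∈)
  ...   | no ∄ = no (tight-blocks A (Core.istight c) (Core.Y⊆X c)
                      λ {i} x∈ → decidable-stable (i ∈? Core.D c) λ i∉ → ∄ (i , x∈ , i∉))
    where
    c : Core (A ↓) X
    c = core (A ↓) ind

-- The core of `X` serves: an index of `I` outside its support is avoided by some matching of `X`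
-- and could be given to the new element.
spanning : ∀ {r m} (A : SetSystem r m) {I X} → M[ A ] X → ¬ M[ A ^ I ] (true ∷ X) →
  ∃₂ λ Y D → Y ⊆ X × Tight A Y D × I ⊆ D
spanning A {I} ind dep = Y , D , Y⊆X , istight , λ {i} i∈I →
  decidable-stable (i ∈? D) λ i∉D → dep (indep-∷ (A ^ I) (free i∉D) (x∈^⁺ A i∈I))
  where open Core (core A ind)

tight-spans : ∀ {r m} (A : SetSystem r m) {I X Y D} → Tight A Y D → Y ⊆ X → I ⊆ D → ¬ M[ A ^ I ] (true ∷ X)
tight-spans A {I} T Y⊆X I⊆D = tight-blocks (A ^ I) T Y⊆X (I⊆D ∘ x∈^⁻ A)

-- Comparing two presentations

≈M-sym : ∀ {m} {N N′ : Matroid m} → N ≈M N′ → N′ ≈M N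
≈M-sym eq X = mk⇔ (Equivalence.from (eq X)) (Equivalence.to (eq X))

≈M-trans : ∀ {m} {N N′ N″ : Matroid m} → N ≈M N′ → N′ ≈M N″ → N ≈M N″
≈M-trans eq eq′ X = mk⇔ (Equivalence.to (eq′ X) ∘ Equivalence.to (eq X)) (Equivalence.from (eq X) ∘ Equivalence.from (eq′ X))

≈M⇒≤w : ∀ {m} {N N′ : Matroid m} → N ≈M N′ → N ≤w N′
≈M⇒≤w eq X = Equivalence.to (eq X)

≤w-antisym : ∀ {m} {N N′ : Matroid m} → N ≤w N′ → N′ ≤w N → N ≈M N′
≤w-antisym le ge X = mk⇔ (le X) (ge X)

-- If G spans Y′ in the common matroid, then G spans in B whatever Y′ spans.
span-transfer : ∀ {r m} (A B : SetSystem r m) {G D Y′ E} → M[ A ] ≈M M[ B ] → Tight A G D →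
  (∀ {e i} → e ∈ Y′ → e ∈ A i → i ∈ D) → Tight B Y′ E →
  ∃₂ λ Y F → Y ⊆ G × Tight B Y F × E ⊆ F
span-transfer A B {G} {D} {Y′} {E} A≈B TG nb TE
  with core B (Equivalence.to (A≈B G) (indep TG))
... | c with tight-∪ (Core.istight c) TE
...   | Z , TZ , _ , Z⁻ , _ = Z , _ , Z⊆G , TZ , q⊆p∪q (Core.D c) E
  where
  Z⊆G : Z ⊆ G
  Z⊆G {e} e∈Z with Z⁻ e∈Z
  ... | inj₁ e∈Y = Core.Y⊆X c e∈Y
  -- Some matching of `G` in `B` avoids the partner of `e`, so `G ∪ ⁅ e ⁆` is independent in `B`,
  -- hence in `A`; as `G` is tight in `A` and the neighbours of `e` lie in its support, `e` is in
  -- `G`.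
  ... | inj₂ (e∈Y′ , i∉D) with Core.free c i∉D
  ...   | ψ , ψm , miss
    with Equivalence.from (A≈B (G ∪ ⁅ e ⁆)) (_ , reroute {A = B} ψm miss (proj₁ (proj₂ (indep TE)) e e∈Y′))
  ...     | θ , θm = covered-within TG (p⊆p∪q _) θm e∈G∪e (nb e∈Y′ (proj₁ θm e e∈G∪e))
    where e∈G∪e = q⊆p∪q G ⁅ e ⁆ (x∈⁅x⁆ e)

record CommonTight {r m} (A B : SetSystem r m) (D E : Subset r) : Set where
  constructor common
  field
    {set} : Subset m
    left  : Tight A set D
    right : Tight B set E

CommonTight-sym : ∀ {r m} {A B : SetSystem r m} {D E} → CommonTight A B D E → CommonTight B A E D
CommonTight-sym (common l r) = common r l

-- If D₁ ∩ D₂ ⊆ D then Y ∪ Y₁ and Y ∪ Y₂ form a modular pair with intersection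
-- spanned by Y; so an element spanned by both Y₁ and Y₂ is spanned by Y.
common-∩-spans : ∀ {r m} (A B : SetSystem r m) {D₁ E₁ D₂ E₂ Y D} → M[ A ] ≈M M[ B ] →
  CommonTight A B D₁ E₁ → CommonTight A B D₂ E₂ → Tight A Y D → D₁ ∩ D₂ ⊆ D →
  ∃₂ λ Y′ E → Y′ ⊆ Y × Tight B Y′ E × E₁ ∩ E₂ ⊆ E
common-∩-spans A B {D₁} {E₁} {D₂} {E₂} {Y} {D} A≈B (common {Y₁} T₁ T₁′) (common {Y₂} T₂ T₂′) T D₁∩D₂⊆D
  with tight-∪ T T₁ | tight-∪ T T₂
... | G₁ , TG₁ , Y⊆G₁ , G₁⁻ , _ | G₂ , TG₂ , Y⊆G₂ , G₂⁻ , _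
  -- `W` will contain both `G₁` and `G₂`: it is the common independent set that `tight-∩` requires
  -- in `B`.
  with tight-∪ TG₁ TG₂
     | span-transfer A B A≈B TG₁ (λ e∈ e∈Ai → q⊆p∪q D D₁ (nbrs T₁ e∈ e∈Ai)) T₁′
     | span-transfer A B A≈B TG₂ (λ e∈ e∈Ai → q⊆p∪q D D₂ (nbrs T₂ e∈ e∈Ai)) T₂′
... | W , TW , G₁⊆W , _ , W⁺ | Z₁ , F₁ , Z₁⊆G₁ , TF₁ , E₁⊆F₁ | Z₂ , F₂ , Z₂⊆G₂ , TF₂ , E₂⊆F₂ =
  Z₁ ∩ Z₂ , F₁ ∩ F₂ ,
  (λ e∈ → let e∈Z₁ , e∈Z₂ = x∈p∩q⁻ Z₁ Z₂ e∈ in G₁∩G₂⊆Y (Z₁⊆G₁ e∈Z₁) (Z₂⊆G₂ e∈Z₂)) ,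
  tight-∩ (Equivalence.to (A≈B W) (indep TW)) (G₁⊆W ∘ Z₁⊆G₁) (G₂⊆W ∘ Z₂⊆G₂) TF₁ TF₂ ,
  λ i∈ → let i∈E₁ , i∈E₂ = x∈p∩q⁻ E₁ E₂ i∈ in x∈p∩q⁺ (E₁⊆F₁ i∈E₁ , E₂⊆F₂ i∈E₂)
  where
  G₁∩G₂⊆Y : ∀ {e} → e ∈ G₁ → e ∈ G₂ → e ∈ Y
  G₁∩G₂⊆Y {e} e∈G₁ e∈G₂ with G₁⁻ e∈G₁ | G₂⁻ e∈G₂
  ... | inj₁ e∈Y | _ = e∈Y
  ... | inj₂ _ | inj₁ e∈Y = e∈Y
  ... | inj₂ (e∈Y₁ , i∉D) | inj₂ (e∈Y₂ , _) =
    contradiction (D₁∩D₂⊆D (x∈p∩q⁺ (nbrs T₁ e∈Y₁ e∈Ai , nbrs T₂ e∈Y₂ e∈Ai))) i∉D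
    where e∈Ai = proj₁ (proj₂ (indep T₁)) e e∈Y₁
  G₂⊆W : G₂ ⊆ W
  G₂⊆W {e} e∈G₂ with e ∈? G₁
  ... | yes e∈G₁ = G₁⊆W e∈G₁
  ... | no e∉G₁ = W⁺ e∈G₂ i∉D∪D₁
    where
    i = proj₁ (indep TG₂) e
    i∉D : i ∉ D
    i∉D = e∉G₁ ∘ Y⊆G₁ ∘ covered-within T Y⊆G₂ (proj₂ (indep TG₂)) e∈G₂
    i∉D∪D₁ : i ∉ D ∪ D₁
    -- The partner `i` lies in `D ∪ D₂` but not in `D`, so in `D₂`; being in `D₁` too would put it
    -- in `D`.
    i∉D∪D₁ i∈ with x∈p∪q⁻ D D₁ i∈ | x∈p∪q⁻ D D₂ (nbrs TG₂ e∈G₂ (proj₁ (proj₂ (indep TG₂)) e e∈G₂))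
    ... | inj₁ i∈D | _ = i∉D i∈D
    ... | inj₂ _ | inj₁ i∈D = i∉D i∈D
    ... | inj₂ i∈D₁ | inj₂ i∈D₂ = i∉D (D₁∩D₂⊆D (x∈p∩q⁺ (i∈D₁ , i∈D₂)))

indep-^-⊆ : ∀ {r m} (A : SetSystem r m) {I I′} → I ⊆ I′ → M[ A ^ I ] ≤w M[ A ^ I′ ]
indep-^-⊆ {r} {m} A {I} {I′} I⊆I′ X (φ , φ∈ , inj) = φ , ∈′ , inj
  where
  ∈′ : ∀ e → e ∈ X → e ∈ (A ^ I′) (φ e)
  ∈′ zero e∈ = x∈^⁺ A (I⊆I′ (x∈^⁻ A (φ∈ zero e∈)))
  ∈′ (suc e) e∈ = there (drop-there (φ∈ (suc e) e∈))

maximal-⊇ : ∀ {m} {P : Subset m → Set} → (∀ X → Dec (P X)) → ∀ {G Y} → Y ⊆ G → P Y →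
  ∃ λ B → Y ⊆ B × B ⊆ G × P B × (∀ e → e ∈ G → e ∉ B → ¬ P (B ∪ ⁅ e ⁆))
maximal-⊇ {m} {P} P? {G} {Y} = go Y (⊃-wellFounded Y)
  where
  go : ∀ Y → Acc _⊃_ Y → Y ⊆ G → P Y →
    ∃ λ B → Y ⊆ B × B ⊆ G × P B × (∀ e → e ∈ G → e ∉ B → ¬ P (B ∪ ⁅ e ⁆))
  go Y (acc rs) Y⊆G p with any? (λ e → (e ∈? G) ×-dec (¬? (e ∈? Y) ×-dec P? (Y ∪ ⁅ e ⁆)))
  ... | no ∄ = Y , id , Y⊆G , p , λ e e∈G e∉Y q → ∄ (e , e∈G , e∉Y , q)
  ... | yes (e , e∈G , e∉Y , q) with go (Y ∪ ⁅ e ⁆) (rs (p⊆p∪q _ , e , q⊆p∪q Y _ (x∈⁅x⁆ e) , e∉Y)) Y∪e⊆G q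
    where
    Y∪e⊆G : Y ∪ ⁅ e ⁆ ⊆ G
    Y∪e⊆G e′∈ = [ Y⊆G , (λ e′∈⁅e⁆ → subst (_∈ G) (sym (x∈⁅y⁆⇒x≡y e e′∈⁅e⁆)) e∈G) ]′ (x∈p∪q⁻ Y ⁅ e ⁆ e′∈)
  ...   | B , ⊆B , rest = B , ⊆B ∘ p⊆p∪q _ , rest

suc∈groundDel : ∀ {n} (D : Subset n) {e} → e ∉ D → suc e ∈ groundDel D
suc∈groundDel (true ∷ D) {zero} e∉D = contradiction here e∉D
suc∈groundDel (false ∷ D) {zero} e∉D = there here
suc∈groundDel (_ ∷ D) {suc e} e∉D with suc∈groundDel D (e∉D ∘ there)
... | there p = there (there p)

LAB-swap : ∀ {r n} (A B : SetSystem r n) → LAB A B → LAB B A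
LAB-swap _ _ (I , cI , J , cJ , eq) = J , cJ , I , cI , ≈M-sym eq

-- Pointwise form of being an intersection of supports of tight sets.
Separated : ∀ {r n} → SetSystem r n → Subset r → Set
Separated A I = ∀ {k} → k ∉ I → ∃₂ λ Y D → Tight A Y D × I ⊆ D × k ∉ D

-- Extensions at the intersection of two common supports

module _ {r} (i₀ : Fin r) where

  common-∩-≤w : ∀ {m} (A B : SetSystem r m) {D₁ E₁ D₂ E₂} → M[ A ] ≈M M[ B ] →
    CommonTight A B D₁ E₁ → CommonTight A B D₂ E₂ → M[ B ^ (E₁ ∩ E₂) ] ≤w M[ A ^ (D₁ ∩ D₂) ]
  common-∩-≤w A B {D₁} {E₁} {D₂} {E₂} A≈B C₁ C₂ (false ∷ X) ind =
    indep-false (A ^ (D₁ ∩ D₂)) i₀ (Equivalence.from (A≈B X) (indep-↓ (B ^ (E₁ ∩ E₂)) ind))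
  common-∩-≤w A B {D₁} {E₁} {D₂} {E₂} A≈B C₁ C₂ (true ∷ X) ind =
    decidable-stable (indep? i₀ (A ^ (D₁ ∩ D₂)) (true ∷ X)) λ dep →
      let Y , D , Y⊆X , T , ⊆D = spanning A (Equivalence.from (A≈B X) (indep-↓ (B ^ (E₁ ∩ E₂)) ind)) dep
          Y′ , E , Y′⊆Y , T′ , ⊆E = common-∩-spans A B A≈B C₁ C₂ T ⊆D
      in tight-spans B T′ (Y⊆X ∘ Y′⊆Y) ⊆E ind

  common-∩-≈ : ∀ {m} (A B : SetSystem r m) {D₁ E₁ D₂ E₂} → M[ A ] ≈M M[ B ] →
    CommonTight A B D₁ E₁ → CommonTight A B D₂ E₂ → M[ A ^ (D₁ ∩ D₂) ] ≈M M[ B ^ (E₁ ∩ E₂) ]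
  common-∩-≈ A B A≈B C₁ C₂ = ≤w-antisym
    (common-∩-≤w B A (≈M-sym A≈B) (CommonTight-sym C₁) (CommonTight-sym C₂))
    (common-∩-≤w A B A≈B C₁ C₂)

  -- Repeated one-element extensions

  tight-false : ∀ {m} (A : SetSystem r m) {I Y D} → Tight A Y D → Tight (A ^ I) (false ∷ Y) D
  tight-false A {I} (tight ind nb sz) =
    tight (indep-false (A ^ I) i₀ ind) (λ { (there e∈) (there e∈Ai) → nb e∈ e∈Ai }) sz

  common-false : ∀ {m} {A B : SetSystem r m} {I J D E} → CommonTight A B D E → CommonTight (A ^ I) (B ^ J) D E
  common-false {A = A} {B} {I} {J} (common l r) = common (tight-false A {I} l) (tight-false B {J} r)

  -- `K` and `L` support a common tight set after finitely many extensions that keep the two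
  -- matroids equal; only the ground set grows, not the index set.
  data EventuallyTight {m} (A B : SetSystem r m) (K L : Subset r) : Set where
    now   : CommonTight A B K L → EventuallyTight A B K L
    later : ∀ I J → M[ A ^ I ] ≈M M[ B ^ J ] → EventuallyTight (A ^ I) (B ^ J) K L → EventuallyTight A B K L

  add-x : ∀ {m} (A : SetSystem r m) {K Z} → M[ A ] Z → ∣ Z ∣ < ∣ K ∣ → M[ A ^ K ] (true ∷ Z)
  add-x A {K} {Z} (φ , φm) lt with any? (λ k → (k ∈? K) ×-dec ¬? (any? λ e → (e ∈? Z) ×-dec (φ e ≟ k)))
  ... | yes (k , k∈K , miss) = indep-∷ (A ^ K) (φ , φm , λ e e∈Z eq → miss (e , e∈Z , eq)) (x∈^⁺ A k∈K)
  ... | no ∄ = contradiction (∣∣-onto-≤ φ λ {k} k∈K →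
      decidable-stable (any? λ e → (e ∈? Z) ×-dec (φ e ≟ k)) λ miss → ∄ (k , k∈K , miss)) (<⇒≱ lt)

  -- Z consists of the copies of x already added; t bounds how many more are needed.
  fill : ∀ t {m} (A B : SetSystem r m) {D₁ E₁ D₂ E₂ Z} → r ≤ t + ∣ Z ∣ → M[ A ] ≈M M[ B ] →
    CommonTight A B D₁ E₁ → CommonTight A B D₂ E₂ → M[ A ] Z →
    (∀ {e i} → e ∈ Z → e ∈ A i → i ∈ D₁ ∩ D₂) → (∀ {e i} → e ∈ Z → e ∈ B i → i ∈ E₁ ∩ E₂) →
    EventuallyTight A B (D₁ ∩ D₂) (E₁ ∩ E₂)
  -- Here `r ≤ ∣ Z ∣`, which bounds the sizes of both supports.
  fill zero A B {D₁} {E₁} {D₂} {E₂} {Z} r≤ A≈B C₁ C₂ ind nbA nbB = now (common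
    (tight ind nbA (≤-trans (∣p∣≤n (D₁ ∩ D₂)) r≤))
    (tight (Equivalence.to (A≈B _) ind) nbB (≤-trans (∣p∣≤n (E₁ ∩ E₂)) r≤)))
  fill (suc t) A B {D₁} {E₁} {D₂} {E₂} {Z} r≤ A≈B C₁ C₂ ind nbA nbB =
    decide (∣ D₁ ∩ D₂ ∣ ≤? ∣ Z ∣) (∣ E₁ ∩ E₂ ∣ ≤? ∣ Z ∣)
    where
    A⁺≈B⁺ = common-∩-≈ A B A≈B C₁ C₂
    nb⁺ : ∀ (S : SetSystem r _) {K} → (∀ {e i} → e ∈ Z → e ∈ S i → i ∈ K) →
      ∀ {e i} → e ∈ true ∷ Z → e ∈ (S ^ K) i → i ∈ K
    nb⁺ S nb {zero} _ e∈ = x∈^⁻ S e∈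
    nb⁺ S nb {suc _} (there e∈Z) (there e∈Si) = nb e∈Z e∈Si
    grow : M[ A ^ (D₁ ∩ D₂) ] (true ∷ Z) → EventuallyTight A B (D₁ ∩ D₂) (E₁ ∩ E₂)
    grow ind⁺ = later (D₁ ∩ D₂) (E₁ ∩ E₂) A⁺≈B⁺
      (fill t (A ^ (D₁ ∩ D₂)) (B ^ (E₁ ∩ E₂)) (subst (r ≤_) (sym (+-suc t ∣ Z ∣)) r≤) A⁺≈B⁺
        (common-false {I = D₁ ∩ D₂} {E₁ ∩ E₂} C₁) (common-false {I = D₁ ∩ D₂} {E₁ ∩ E₂} C₂) ind⁺
        (nb⁺ A nbA) (nb⁺ B nbB))
    decide : Dec (∣ D₁ ∩ D₂ ∣ ≤ ∣ Z ∣) → Dec (∣ E₁ ∩ E₂ ∣ ≤ ∣ Z ∣) → EventuallyTight A B (D₁ ∩ D₂) (E₁ ∩ E₂)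
    decide (yes D≤) (yes E≤) = now (common (tight ind nbA D≤) (tight (Equivalence.to (A≈B _) ind) nbB E≤))
    decide (no D≰) _ = grow (add-x A {D₁ ∩ D₂} ind (≰⇒> D≰))
    -- The support in `B` has room for another copy; `A⁺≈B⁺` carries the resulting independence to
    -- `A`.
    decide (yes _) (no E≰) = grow (Equivalence.from (A⁺≈B⁺ _)
      (add-x B {E₁ ∩ E₂} (Equivalence.to (A≈B _) ind) (≰⇒> E≰)))

  empty-indep : ∀ {m} (A : SetSystem r m) → M[ A ] ⊥
  empty-indep A = (λ _ → i₀) , (λ e e∈ → contradiction e∈ ∉⊥) , λ e e′ e∈ → contradiction e∈ ∉⊥

  -- `C′` stays tight through the extensions until `K` and `L` support a common tight set; then
  -- `fill` starts from the empty set.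
  eventually-∩ : ∀ {m} {A B : SetSystem r m} {K L D E} → M[ A ] ≈M M[ B ] →
    EventuallyTight A B K L → CommonTight A B D E → EventuallyTight A B (K ∩ D) (L ∩ E)
  eventually-∩ {A = A} {B} A≈B (now C) C′ =
    fill r A B (m≤m+n r _) A≈B C C′ (empty-indep A)
      (λ e∈ → contradiction e∈ ∉⊥) (λ e∈ → contradiction e∈ ∉⊥)
  eventually-∩ A≈B (later I J A⁺≈B⁺ ev) C′ =
    later I J A⁺≈B⁺ (eventually-∩ A⁺≈B⁺ ev (common-false {I = I} {J} C′))

  -- The newest element is always `zero`, so the one added earlier with `I` moves to position one,
  -- where the set omits it.
  skip-x : ∀ {m} (A : SetSystem r m) {I K b X} → M[ A ^ K ] (b ∷ X) → M[ (A ^ I) ^ K ] (b ∷ false ∷ X)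
  skip-x {m} A {I} {K} {b} {X} (φ , φ∈ , inj) = φ⁺ , ∈⁺ , inj⁺
    where
    φ⁺ : Fin (suc (suc m)) → Fin r
    φ⁺ zero = φ zero
    φ⁺ (suc zero) = i₀
    φ⁺ (suc (suc e)) = φ (suc e)
    ∈⁺ : ∀ e → e ∈ b ∷ false ∷ X → e ∈ ((A ^ I) ^ K) (φ⁺ e)
    ∈⁺ zero here = x∈^⁺ (A ^ I) {K} (x∈^⁻ A (φ∈ zero here))
    ∈⁺ (suc (suc e)) (there (there e∈)) = there (there (drop-there (φ∈ (suc e) (there e∈))))
    inj⁺ : ∀ e e′ → e ∈ b ∷ false ∷ X → e′ ∈ b ∷ false ∷ X → φ⁺ e ≡ φ⁺ e′ → e ≡ e′
    inj⁺ zero zero _ _ _ = refl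
    inj⁺ zero (suc (suc e)) here (there (there p)) eq = contradiction (inj zero (suc e) here (there p) eq) λ ()
    inj⁺ (suc (suc e)) zero (there (there p)) here eq = contradiction (inj (suc e) zero (there p) here eq) λ ()
    inj⁺ (suc (suc e)) (suc (suc e′)) (there (there p)) (there (there p′)) eq =
      cong suc (inj (suc e) (suc e′) (there p) (there p′) eq)

  unskip-x : ∀ {m} (A : SetSystem r m) {I K b X} → M[ (A ^ I) ^ K ] (b ∷ false ∷ X) → M[ A ^ K ] (b ∷ X)
  unskip-x {m} A {I} {K} {b} {X} (φ , φ∈ , inj) = φ⁻ , ∈⁻ , inj⁻
    where
    φ⁻ : Fin (suc m) → Fin r
    φ⁻ zero = φ zero
    φ⁻ (suc e) = φ (suc (suc e))
    ∈⁻ : ∀ e → e ∈ b ∷ X → e ∈ (A ^ K) (φ⁻ e)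
    ∈⁻ zero here = x∈^⁺ A {K} (x∈^⁻ (A ^ I) (φ∈ zero here))
    ∈⁻ (suc e) (there e∈) = there (drop-there (drop-there (φ∈ (suc (suc e)) (there (there e∈)))))
    inj⁻ : ∀ e e′ → e ∈ b ∷ X → e′ ∈ b ∷ X → φ⁻ e ≡ φ⁻ e′ → e ≡ e′
    inj⁻ zero zero _ _ _ = refl
    inj⁻ zero (suc e) here (there p) eq = contradiction (inj zero (suc (suc e)) here (there (there p)) eq) λ ()
    inj⁻ (suc e) zero (there p) here eq = contradiction (inj (suc (suc e)) zero (there (there p)) here eq) λ ()
    inj⁻ (suc e) (suc e′) (there p) (there p′) eq =
      suc-injective (inj (suc (suc e)) (suc (suc e′)) (there (there p)) (there (there p′)) eq)

  -- A tight pair is intersected with itself; an extension step is undone by restricting to sets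
  -- that omit the added element.
  eventually-≈ : ∀ {m} (A B : SetSystem r m) {K L} → M[ A ] ≈M M[ B ] →
    EventuallyTight A B K L → M[ A ^ K ] ≈M M[ B ^ L ]
  eventually-≈ A B {K} {L} A≈B (now C)
    with common-∩-≈ A B A≈B C C
  ... | eq rewrite ∩-idem K | ∩-idem L = eq
  eventually-≈ A B {K} {L} A≈B (later I J A⁺≈B⁺ ev) (b ∷ X)
    with eventually-≈ (A ^ I) (B ^ J) A⁺≈B⁺ ev (b ∷ false ∷ X)
  ... | eq = mk⇔ (unskip-x B {J} {L} ∘ Equivalence.to eq ∘ skip-x A {I} {K})
                 (unskip-x A {I} {K} ∘ Equivalence.from eq ∘ skip-x B {J} {L})

  -- Closed index sets as intersections of supports

  InL⇒Separated : ∀ {n} (A : SetSystem r n) {I} → InL A I → Separated A I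
  InL⇒Separated {n} A {I} closed {k} k∉I with anySubset? witness?
    where
    -- A witness shows that `x` is not a coloop after deleting `A k`. Its core has a support without
    -- `k`, since every index there is matched to an element outside `A k`. Without witnesses `x` is
    -- a coloop, against closedness.
    Witness : Subset n → Set
    Witness X = M[ A ] X × (∀ e → e ∈ X → e ∉ A k) × ¬ M[ A ^ I ] (true ∷ X)
    witness? : ∀ X → Dec (Witness X)
    witness? X = indep? i₀ A X ×-dec (all? (λ e → (e ∈? X) →-dec ¬? (e ∈? A k)) ×-dec ¬? (indep? i₀ (A ^ I) (true ∷ X)))
  ... | yes (X , ind , avoid , dep) =
    let Y , D , Y⊆X , T , I⊆D = spanning A ind dep
    in Y , D , T , I⊆D , λ k∈D →
      let φ , φm = indep T
          e , e∈Y , eq = covered T φm k∈D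
      in avoid e (Y⊆X e∈Y) (subst (λ i → e ∈ A i) eq (proj₁ φm e e∈Y))
  ... | no ∄ = contradiction (closed k (inj₂ (k∉I , coloop))) k∉I
    where
    coloop : XColoop A I k
    coloop (true ∷ X) _ = here
    coloop (false ∷ X) (_ , (ind , avoid) , max) = contradiction
      (indep-↓ (A ^ I) ind , (λ e e∈ → avoid e (there e∈)) , λ ind⁺ →
        max zero here (λ ()) (subst (λ Z → M[ A ^ I ] (true ∷ Z)) (sym (∪-identityʳ X)) ind⁺ ,
          λ { e (there e∈) → avoid e (there (subst (e ∈_) (∪-identityʳ X) e∈)) }))
      λ w → ∄ (X , w)

  -- A tight `Y` whose support contains `I` and misses `k` avoids `A k`. It extends to a basis of
  -- the deletion, which cannot contain `x` because `Y` spans `x`.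
  Separated⇒InL : ∀ {n} (A : SetSystem r n) {I} → Separated A I → InL A I
  Separated⇒InL A _ k (inj₁ k∈I) = k∈I
  Separated⇒InL A {I} sep k (inj₂ (k∉I , coloop)) with sep k∉I
  ... | Y , D , T , I⊆D , k∉D
    with maximal-⊇ {P = M[ A ^ I ] ＼ A k} indep-avoiding? {groundDel (A k)} {false ∷ Y}
           (λ { (there e∈) → suc∈groundDel (A k) (avoid e∈) })
           (indep-false (A ^ I) i₀ (indep T) , λ { e (there e∈) → avoid e∈ })
    where
    avoid : ∀ {e} → e ∈ Y → e ∉ A k
    avoid e∈Y e∈Ak = k∉D (nbrs T e∈Y e∈Ak)
    indep-avoiding? : ∀ X → Dec ((M[ A ^ I ] ＼ A k) X)
    indep-avoiding? X = indep? i₀ (A ^ I) X ×-dec all? (λ e → (suc e ∈? X) →-dec ¬? (e ∈? A k))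
  ... | (b ∷ B) , Y⊆B , basis with coloop (b ∷ B) basis
  ...   | here = contradiction (proj₁ (proj₁ (proj₂ basis))) (tight-spans A T (drop-there ∘ Y⊆B ∘ there) I⊆D)

  InL-∪ : ∀ {n} (A : SetSystem r n) {I I′} → InL A I → InL A I′ → InL A (I ∪ I′)
  InL-∪ A {I} {I′} c c′ = Separated⇒InL A λ k∉ →
    let Y , D , T , I⊆D , k∉D = InL⇒Separated A c (k∉ ∘ x∈p∪q⁺ ∘ inj₁)
        Y′ , D′ , T′ , I′⊆D′ , k∉D′ = InL⇒Separated A c′ (k∉ ∘ x∈p∪q⁺ ∘ inj₂)
        Z , TZ , _ = tight-∪ T T′
    in Z , D ∪ D′ , TZ ,
       (λ i∈ → x∈p∪q⁺ ([ inj₁ ∘ I⊆D , inj₂ ∘ I′⊆D′ ]′ (x∈p∪q⁻ I I′ i∈))) ,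
       λ k∈ → [ k∉D , k∉D′ ]′ (x∈p∪q⁻ D D′ k∈)

  InL-∩ : ∀ {n} (A : SetSystem r n) {I I′} → InL A I → InL A I′ → InL A (I ∩ I′)
  InL-∩ A {I} {I′} c c′ = Separated⇒InL A sep
    where
    sep : Separated A (I ∩ I′)
    sep {k} k∉ with k ∈? I
    ... | no k∉I = let Y , D , T , I⊆D , k∉D = InL⇒Separated A c k∉I in
                   Y , D , T , I⊆D ∘ p∩q⊆p I I′ , k∉D
    ... | yes k∈I = let Y , D , T , I′⊆D , k∉D = InL⇒Separated A c′ (λ k∈I′ → k∉ (x∈p∩q⁺ (k∈I , k∈I′))) in
                    Y , D , T , I′⊆D ∘ p∩q⊆q I I′ , k∉D

  -- For `k` in `I` but not in `I′`, take a tight set separating `k` from `I′`: with `x` added it is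
  -- independent for `I`, through `k`, and dependent for `I′`.
  ≤w⇒⊆ : ∀ {n} (A : SetSystem r n) {I I′} → InL A I′ → M[ A ^ I ] ≤w M[ A ^ I′ ] → I ⊆ I′
  ≤w⇒⊆ A {I} {I′} c le {k} k∈I = decidable-stable (k ∈? I′) λ k∉I′ →
    let Y , D , T , I′⊆D , k∉D = InL⇒Separated A c k∉I′
        φ , φ∈ , inj = indep T
        miss = λ e e∈Y eq → k∉D (nbrs T e∈Y (subst (λ i → e ∈ A i) eq (φ∈ e e∈Y)))
    in tight-spans A T id I′⊆D (le _ (indep-∷ (A ^ I) (φ , (φ∈ , inj) , miss) (x∈^⁺ A k∈I)))

  -- Alternately shrinking a set tight for A to one tight for B, and back, stabilises.
  common-below : ∀ {m} (A B : SetSystem r m) {I J Y D} → Acc _⊂_ Y →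
    M[ A ] ≈M M[ B ] → M[ A ^ I ] ≈M M[ B ^ J ] → Tight A Y D → I ⊆ D →
    Σ (Subset m) λ Y′ → ∃₂ λ D′ E′ → Y′ ⊆ Y × Tight A Y′ D′ × Tight B Y′ E′ × I ⊆ D′ × J ⊆ E′
  common-below A B {I} {J} {Y} {D} (acc rs) A≈B eq T I⊆D
    with spanning B {J} (Equivalence.to (A≈B Y) (indep T)) (tight-spans A T id I⊆D ∘ Equivalence.from (eq (true ∷ Y)))
  ... | Y₁ , E , Y₁⊆Y , T₁ , J⊆E with Y ⊆? Y₁
  ...   | yes Y⊆Y₁ = Y , D , E , id , T , subst (λ Z → Tight B Z E) (⊆-antisym Y₁⊆Y Y⊆Y₁) T₁ , I⊆D , J⊆E
  ...   | no Y⊈Y₁ =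
    let Y′ , E′ , D′ , Y′⊆Y₁ , TB , TA , J⊆E′ , I⊆D′ =
          common-below B A (rs (Y₁⊆Y , ⊈⇒∃ Y⊈Y₁)) (≈M-sym A≈B) (≈M-sym eq) T₁ J⊆E
    in Y′ , D′ , E′ , Y₁⊆Y ∘ Y′⊆Y₁ , TA , TB , I⊆D′ , J⊆E′

  -- Shrinking by `common-below` cannot bring `k` into the support, as each index of `D′` is a
  -- neighbour of an element of `Y′ ⊆ Y`.
  common-separated : ∀ {m} (A B : SetSystem r m) {I J k} → M[ A ] ≈M M[ B ] → M[ A ^ I ] ≈M M[ B ^ J ] →
    InL A I → k ∉ I → ∃₂ λ D E → CommonTight A B D E × I ⊆ D × J ⊆ E × k ∉ D
  common-separated A B A≈B eq c k∉I =
    let Y , D , T , I⊆D , k∉D = InL⇒Separated A c k∉I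
        Y′ , D′ , E′ , Y′⊆Y , TA , TB , I⊆D′ , J⊆E′ = common-below A B (⊂-wellFounded Y) A≈B eq T I⊆D
        φ , φm = indep TA
    in D′ , E′ , common TA TB , I⊆D′ , J⊆E′ , λ k∈D′ →
       let e , e∈Y′ , φe≡k = covered TA φm k∈D′
       in k∉D (nbrs T (Y′⊆Y e∈Y′) (subst (λ i → e ∈ A i) φe≡k (proj₁ φm e e∈Y′)))

  -- Intersecting with a matched pair of closed sets

  abstract
    -- While `K` has an index outside `I`, a cut removes it; since `I ⊆ D` and `J ⊆ E`, no cut loses
    -- anything of `K ∩ I` or `L ∩ J`.
    trim : {P : Subset r → Subset r → Set} {I J : Subset r} →
      (∀ {k} → k ∉ I → ∃₂ λ D E → I ⊆ D × J ⊆ E × k ∉ D × (∀ {K L} → P K L → P (K ∩ D) (L ∩ E))) →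
      ∀ {K L} → P K L →
      ∃₂ λ K′ L′ → P K′ L′ × K′ ⊆ K × L′ ⊆ L × K′ ⊆ I × K ∩ I ⊆ K′ × L ∩ J ⊆ L′
    trim {P} {I} {J} cut = go (⊂-wellFounded _)
      where
      narrow : ∀ {K I D : Subset r} → I ⊆ D → K ∩ I ⊆ (K ∩ D) ∩ I
      narrow {K} {I} I⊆D i∈ = let i∈K , i∈I = x∈p∩q⁻ K I i∈ in x∈p∩q⁺ (x∈p∩q⁺ (i∈K , I⊆D i∈I) , i∈I)
      go : ∀ {K L} → Acc _⊂_ K → P K L →
        ∃₂ λ K′ L′ → P K′ L′ × K′ ⊆ K × L′ ⊆ L × K′ ⊆ I × K ∩ I ⊆ K′ × L ∩ J ⊆ L′
      go {K} {L} (acc rs) p with K ⊆? I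
      ... | yes K⊆I = K , L , p , id , id , K⊆I , p∩q⊆p K I , p∩q⊆p L J
      ... | no K⊈I =
        let k , k∈K , k∉I = ⊈⇒∃ K⊈I
            D , E , I⊆D , J⊆E , k∉D , step = cut k∉I
            K′ , L′ , p′ , K′⊆ , L′⊆ , K′⊆I , ⊆K′ , ⊆L′ =
              go (rs (p∩q⊆p K D , k , k∈K , k∉D ∘ p∩q⊆q K D)) (step p)
        in K′ , L′ , p′ , p∩q⊆p K D ∘ K′⊆ , p∩q⊆p L E ∘ L′⊆ , K′⊆I , ⊆K′ ∘ narrow I⊆D , ⊆L′ ∘ narrow J⊆E

  -- The first trimming brings `K` down to `K ∩ I`; the second, with the roles of `A` and `B`
  -- exchanged, brings the other component to `L ∩ J` and preserves `K ∩ I`.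
  eventually-∩-closed : ∀ {m} (A B : SetSystem r m) {I J K L} → M[ A ] ≈M M[ B ] → M[ A ^ I ] ≈M M[ B ^ J ] →
    InL A I → InL B J → EventuallyTight A B K L → EventuallyTight A B (K ∩ I) (L ∩ J)
  eventually-∩-closed A B {I} {J} {K} {L} A≈B eq cI cJ ev =
    let K₁ , L₁ , ev₁ , K₁⊆K , L₁⊆L , K₁⊆I , ⊆K₁ , ⊆L₁ = trim {EventuallyTight A B} {I} {J}
          (λ k∉I → let D , E , C , I⊆D , J⊆E , k∉D = common-separated A B A≈B eq cI k∉I
                   in D , E , I⊆D , J⊆E , k∉D , λ ev → eventually-∩ A≈B ev C) ev
        L₂ , K₂ , ev₂ , L₂⊆L₁ , K₂⊆K₁ , L₂⊆J , ⊆L₂ , ⊆K₂ = trim {flip (EventuallyTight A B)} {J} {I}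
          (λ k∉J → let E , D , C , J⊆E , I⊆D , k∉E = common-separated B A (≈M-sym A≈B) (≈M-sym eq) cJ k∉J
                   in E , D , J⊆E , I⊆D , k∉E , λ ev → eventually-∩ A≈B ev (CommonTight-sym C)) ev₁
    in subst₂ (EventuallyTight A B)
         (⊆-antisym (λ i∈ → x∈p∩q⁺ (K₁⊆K (K₂⊆K₁ i∈) , K₁⊆I (K₂⊆K₁ i∈)))
                    (λ i∈ → ⊆K₂ (x∈p∩q⁺ (⊆K₁ i∈ , p∩q⊆q K I i∈))))
         (⊆-antisym (λ i∈ → x∈p∩q⁺ (L₁⊆L (L₂⊆L₁ i∈) , L₂⊆J i∈))
                    (λ i∈ → ⊆L₂ (x∈p∩q⁺ (⊆L₁ i∈ , p∩q⊆q L J i∈))))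
         ev₂

  -- A matching gives `x` an index of `I` or of `I′`, so `X` is already independent for one of the
  -- two.
  ∪-≤w : ∀ {n} (A B : SetSystem r n) {I I′ J J′} → M[ A ^ I ] ≤w M[ B ^ J ] → M[ A ^ I′ ] ≤w M[ B ^ J′ ] →
    M[ A ^ (I ∪ I′) ] ≤w M[ B ^ (J ∪ J′) ]
  ∪-≤w A B {I} {I′} {J} {J′} le le′ X (φ , φ∈ , inj) with φ zero ∈? I
  ... | yes φx∈I = indep-^-⊆ B {J} (p⊆p∪q J′) X (le X (φ , ∈I , inj))
    where
    ∈I : ∀ e → e ∈ X → e ∈ (A ^ I) (φ e)
    ∈I zero _ = x∈^⁺ A φx∈I
    ∈I (suc e) e∈ = there (drop-there (φ∈ (suc e) e∈))
  ... | no φx∉I = indep-^-⊆ B (q⊆p∪q J J′) X (le′ X (φ , ∈I′ , inj))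
    where
    ∈I′ : ∀ e → e ∈ X → e ∈ (A ^ I′) (φ e)
    ∈I′ zero e∈ = x∈^⁺ A ([ flip contradiction φx∉I , id ]′ (x∈p∪q⁻ I I′ (x∈^⁻ A (φ∈ zero e∈))))
    ∈I′ (suc e) e∈ = there (drop-there (φ∈ (suc e) e∈))

  -- Sublattices and isomorphism

  module _ {n} (A B : SetSystem r n) (A≈B : M[ A ] ≈M M[ B ]) (basis : ∃ λ X → M[ A ] X × ∣ X ∣ ≡ r) where

    sublatticeL : IsSublatticeL A B
    sublatticeL I I′ (cI , J , cJ , eq) (cI′ , J′ , cJ′ , eq′) =
      (InL-∪ A cI cI′ , J ∪ J′ , InL-∪ B cJ cJ′ ,
        ≤w-antisym (∪-≤w A B {I} {I′} {J} {J′} (≈M⇒≤w eq) (≈M⇒≤w eq′))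
                   (∪-≤w B A {J} {J′} {I} {I′} (≈M⇒≤w (≈M-sym eq)) (≈M⇒≤w (≈M-sym eq′)))) ,
      (InL-∩ A cI cI′ , J ∩ J′ , InL-∩ B cJ cJ′ , ∩-≈)
      where
      -- A basis has `r` elements, so it is tight with the whole index set as support in both
      -- presentations.
      top : CommonTight A B ⊤ ⊤
      top = let X , ind , ∣X∣≡r = basis
                le = ≤-reflexive (trans (∣⊤∣≡n r) (sym ∣X∣≡r))
            in common (tight ind (λ _ _ → ∈⊤) le) (tight (Equivalence.to (A≈B X) ind) (λ _ _ → ∈⊤) le)
      ∩-≈ : M[ A ^ (I ∩ I′) ] ≈M M[ B ^ (J ∩ J′) ]
      -- From `⊤` the pair is cut down first to `I` and `J`, then to the two meets.
      ∩-≈ = eventually-≈ A B A≈B (eventually-∩-closed A B A≈B eq′ cI′ cJ′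
        (subst₂ (EventuallyTight A B) (∩-identityˡ I) (∩-identityˡ J)
          (eventually-∩-closed A B A≈B eq cI cJ (now top))))

    -- By `≤w⇒⊆` the weak order on closed indices is inclusion, so a join has index `I₁ ∪ I₂` and a
    -- meet `I₁ ∩ I₂`.
    sublatticeT : IsSublatticeT A B
    sublatticeT I₁ I₂ I p₁@(c₁ , _) p₂@(c₂ , _) = join , meet
      where
      join : IsJoinInT A I₁ I₂ I → InLAB A B I
      join (cI , le₁ , le₂ , least) = subst (InLAB A B) (⊆-antisym
          (λ i∈ → [ ≤w⇒⊆ A cI le₁ , ≤w⇒⊆ A cI le₂ ]′ (x∈p∪q⁻ I₁ I₂ i∈))
          (≤w⇒⊆ A c∪ (least (I₁ ∪ I₂) c∪ (indep-^-⊆ A {I₁} (p⊆p∪q I₂)) (indep-^-⊆ A (q⊆p∪q I₁ I₂)))))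
        (proj₁ (sublatticeL I₁ I₂ p₁ p₂))
        where c∪ = InL-∪ A c₁ c₂
      meet : IsMeetInT A I₁ I₂ I → InLAB A B I
      meet (cI , le₁ , le₂ , greatest) = subst (InLAB A B) (⊆-antisym
          (≤w⇒⊆ A cI (greatest (I₁ ∩ I₂) c∩ (indep-^-⊆ A (p∩q⊆p I₁ I₂)) (indep-^-⊆ A (p∩q⊆q I₁ I₂))))
          (λ i∈ → x∈p∩q⁺ (≤w⇒⊆ A c₁ le₁ i∈ , ≤w⇒⊆ A c₂ le₂ i∈)))
        (proj₂ (sublatticeL I₁ I₂ p₁ p₂))
        where c∩ = InL-∩ A c₁ c₂

  -- Inclusion of closed indices amounts to the weak order of the matroids, which both presentations
  -- share.
  ⊆-transfer : ∀ {n} (A B : SetSystem r n) {I I′ J J′} → InL B J′ →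
    M[ A ^ I ] ≈M M[ B ^ J ] → M[ A ^ I′ ] ≈M M[ B ^ J′ ] → I ⊆ I′ → J ⊆ J′
  ⊆-transfer A B cJ′ eq eq′ I⊆I′ = ≤w⇒⊆ B cJ′ λ X →
    Equivalence.to (eq′ X) ∘ indep-^-⊆ A I⊆I′ X ∘ Equivalence.from (eq X)

  isomorphic : ∀ {n} (A B : SetSystem r n) → Isomorphic A B
  isomorphic A B = LAB-swap A B , LAB-swap B A , (λ _ → refl) , (λ _ → refl) ,
    λ (I , cI , J , cJ , eq) (I′ , cI′ , J′ , cJ′ , eq′) →
      mk⇔ (⊆-transfer A B cJ′ eq eq′) (⊆-transfer B A cI′ (≈M-sym eq) (≈M-sym eq′))

theorem3p14 : ∀ {r n : ℕ} (M : Matroid n) (A B : SetSystem r n) →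
    IsPresentation M A → IsPresentation M B →
    IsSublatticeL A B × IsSublatticeL B A × Isomorphic A B ×
    IsSublatticeT A B × IsSublatticeT B A
-- With `r` zero there is no `i₀`, but the only index set is `[]`.
theorem3p14 {zero} M A B _ _ =
  (λ { [] [] p _ → p , p }) , (λ { [] [] p _ → p , p }) ,
  (LAB-swap A B , LAB-swap B A , (λ _ → refl) , (λ _ → refl) , λ _ _ → mk⇔ (λ { _ {()} }) (λ { _ {()} })) ,
  (λ { [] [] [] p _ → (λ _ → p) , (λ _ → p) }) , (λ { [] [] [] p _ → (λ _ → p) , (λ _ → p) })
theorem3p14 {suc r} M A B (M≈A , (X , indX , ∣X∣≡r) , _) (M≈B , _) =
  sublatticeL zero A B A≈B basisA , sublatticeL zero B A (≈M-sym A≈B) basisB , isomorphic zero A B ,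
  sublatticeT zero A B A≈B basisA , sublatticeT zero B A (≈M-sym A≈B) basisB
  where
  A≈B : M[ A ] ≈M M[ B ]
  A≈B = ≈M-trans (≈M-sym M≈A) M≈B
  basisA = X , Equivalence.to (M≈A X) indX , ∣X∣≡r
  basisB = X , Equivalence.to (M≈B X) indX , ∣X∣≡r
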